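{- Let $a$ and $b$ be positive integers. All positive integer solutions of the equation $x^{2}-(a^{2}b^{2}-2b)y^{2}=1$ are given by $$(x_{n},y_{n})=\left(\tfrac{1}{2}V_{n}(2a^{2}b-2,-1),\;a\,U_{n}(2a^{2}b-2,-1)\right)$$ with $n\ge 1$.
   Context: For non-zero integers $k,s$ with $k^2+4s>0$, the generalized Fibonacci sequence is defined by $U_0(k,s)=0$, $U_1(k,s)=1$, $U_{n+1}(k,s)=kU_n(k,s)+sU_{n-1}(k,s)$ for $n\ge 1$, and the generalized Lucas sequence by $V_0(k,s)=2$, $V_1(k,s)=k$, $V_{n+1}(k,s)=kV_n(k,s)+sV_{n-1}(k,s)$ for $n\ge 1$.
   Formalization: The pairs (a,b) = (1,1) and (1,2) are excluded by requiring k = 2a²b−2 to be non-zero with k²−4 > 0, as the definition of U_n and V_n demands; for (1,1) the stated claim fails (n = 1 would give (0,1)). -}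

module Defs where

open import Data.Nat.Base using (ℕ; zero; suc)
open import Data.Integer.Base using (ℤ; 0ℤ; 1ℤ; +_; _+_; _-_; _*_; _^_; _<_)
open import Data.Product.Base using (_×_)
open import Relation.Binary.PropositionalEquality.Core using (_≡_; _≢_)

-- The conditions on (k , s) under which the sequences U and V below are
-- considered. The recursions themselves make sense for all integers, so U and V
-- are total functions and this is assumed separately where they are used.
record Admissible (k s : ℤ) : Set where
  field
    k≢0          : k ≢ 0ℤ
    s≢0          : s ≢ 0ℤ
    discriminant : 0ℤ < k ^ 2 + + 4 * s

-- Generalized Fibonacci sequence.
U : ℤ → ℤ → ℕ → ℤ
U k s zero          = 0ℤ
U k s (suc zero)    = 1ℤ
U k s (suc (suc n)) = k * U k s (suc n) + s * U k s n

-- Generalized Lucas sequence.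
V : ℤ → ℤ → ℕ → ℤ
V k s zero          = + 2
V k s (suc zero)    = k
V k s (suc (suc n)) = k * V k s (suc n) + s * V k s n

IsPositivePellSolution : (d x y : ℤ) → Set
IsPositivePellSolution d x y =
  0ℤ < x × 0ℤ < y × x ^ 2 - d * y ^ 2 ≡ 1ℤ

{-# OPTIONS --safe #-}
-- A positive solution (p , a) of the Pell equation x² - d y² = 1 with a minimal
-- generates all the others: multiplication by p - a √d turns a positive solution
-- with y > a into a positive one with a smaller y. By Cayley–Hamilton the powers of
-- p + a √d satisfy the recursion with parameters (2 p , -1), hence are (V/2 , a U).
-- For d = a² b² - 2 b take p = a² b - 1; a solution with 0 < y < a is impossible
-- because then a b y - 1 < x < a b y.
module Submission where

open import Defs
open import Algebra.Bundles using (AbelianGroup)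
open import Algebra.Properties.Group using (∙-cancelʳ)
open import Data.Nat.Base as ℕ using (ℕ; zero; suc)
open import Data.Nat.Induction using (<-wellFounded)
open import Data.Integer.Base
  using (ℤ; 0ℤ; 1ℤ; -1ℤ; +_; _+_; _-_; _*_; -_; _^_; _≤_; _<_; +<+; pred; ∣_∣; positive; nonNegative)
open import Data.Integer.Properties
open import Data.Integer.Tactic.RingSolver using (solve-∀)
open import Data.Product.Base using (_×_; _,_; ∃-syntax)
open import Induction.WellFounded using (Acc; acc)
open import Relation.Binary.Definitions using (tri<; tri≈; tri>)
open import Relation.Binary.PropositionalEquality
open import Relation.Nullary using (contradiction)

-- Order, squares and absolute values in ℤ.

0<i*j : ∀ {i j} → 0ℤ < i → 0ℤ < j → 0ℤ < i * j
0<i*j {i} {j} 0<i 0<j = subst (_< i * j) (*-zeroʳ i) (*-monoˡ-<-pos i {{positive 0<i}} 0<j)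

0≤i*j : ∀ {i j} → 0ℤ ≤ i → 0ℤ ≤ j → 0ℤ ≤ i * j
0≤i*j {i} {j} 0≤i 0≤j = subst (_≤ i * j) (*-zeroʳ i) (*-monoˡ-≤-nonNeg i {{nonNegative 0≤i}} 0≤j)

0<i⇒i≤j*i : ∀ {i j} → 0ℤ < i → 0ℤ < j → i ≤ j * i
0<i⇒i≤j*i {i} {j} 0<i 0<j =
  subst (_≤ j * i) (*-identityˡ i)
    (*-monoʳ-≤-nonNeg i {{nonNegative (<⇒≤ 0<i)}} (i<j⇒suc[i]≤j 0<j))

0<i⇒1<2*i : ∀ {i} → 0ℤ < i → 1ℤ < + 2 * i
0<i⇒1<2*i 0<i =
  <-≤-trans (+<+ (ℕ.s≤s (ℕ.s≤s ℕ.z≤n))) (*-monoˡ-≤-nonNeg (+ 2) (i<j⇒suc[i]≤j 0<i))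

square-mono-≤ : ∀ {i j} → 0ℤ ≤ i → i ≤ j → i * i ≤ j * j
square-mono-≤ {i} {j} 0≤i i≤j =
  ≤-trans (*-monoˡ-≤-nonNeg i {{nonNegative 0≤i}} i≤j)
          (*-monoʳ-≤-nonNeg j {{nonNegative (≤-trans 0≤i i≤j)}} i≤j)

square-mono-< : ∀ {i j} → 0ℤ ≤ i → i < j → i * i < j * j
square-mono-< {i} {j} 0≤i i<j =
  ≤-<-trans (*-monoˡ-≤-nonNeg i {{nonNegative 0≤i}} (<⇒≤ i<j))
            (*-monoʳ-<-pos j {{positive (≤-<-trans 0≤i i<j)}} i<j)

square-cancel-< : ∀ {i j} → 0ℤ ≤ j → i * i < j * j → i < j
square-cancel-< 0≤j i²<j² = ≰⇒> λ j≤i → <⇒≱ i²<j² (square-mono-≤ 0≤j j≤i)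

square-cancel-≤ : ∀ {i j} → 0ℤ ≤ j → i * i ≤ j * j → i ≤ j
square-cancel-≤ 0≤j i²≤j² = ≮⇒≥ λ j<i → ≤⇒≯ i²≤j² (square-mono-< 0≤j j<i)

square-injective : ∀ {i j} → 0ℤ ≤ i → 0ℤ ≤ j → i * i ≡ j * j → i ≡ j
square-injective 0≤i 0≤j i²≡j² =
  ≤-antisym (square-cancel-≤ 0≤j (≤-reflexive i²≡j²))
            (square-cancel-≤ 0≤i (≤-reflexive (sym i²≡j²)))

-- Reads a strict inequality off a ring identity: only the remainders `s` and `t` are left to
-- compare. Below, `i` and `j` are squares.
exchange-< : ∀ {i j s t} → j + s ≡ i + t → s < t → i < j
exchange-< j+s≡i+t s<t = ≰⇒> λ j≤i → <-irrefl j+s≡i+t (+-mono-≤-< j≤i s<t)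

∣-∣-mono-< : ∀ {i j} → 0ℤ < i → i < j → ∣ i ∣ ℕ.< ∣ j ∣
∣-∣-mono-< (+<+ _) (+<+ m<n) = m<n

norm : ∀ d x y → x ^ 2 - d * y ^ 2 ≡ x * x - d * (y * y)
norm = unfolded
  where
  -- `x ^ 2` reduces to `x * (x * 1ℤ)`; later ring identities use the same spelling.
  unfolded : ∀ d x y → x * (x * 1ℤ) - d * (y * (y * 1ℤ)) ≡ x * x - d * (y * y)
  unfolded = solve-∀

-- Powers of `p + a √d` and their linear recursion.

module Powers (d p a : ℤ) where

  -- xₙ n + yₙ n √d = (p + a √d) ^ n
  xₙ yₙ : ℕ → ℤ
  xₙ zero    = 1ℤ
  xₙ (suc n) = p * xₙ n + d * a * yₙ n
  yₙ zero    = 0ℤ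
  yₙ (suc n) = a * xₙ n + p * yₙ n

  module _ (unit : p * p - d * (a * a) ≡ 1ℤ) where

    -- The norm `x² - d y²` is multiplicative, and `p + a √d` has norm 1.
    norm-step : ∀ x y → x * x - d * (y * y) ≡ 1ℤ →
      let x′ = p * x + d * a * y
          y′ = a * x + p * y
      in x′ * x′ - d * (y′ * y′) ≡ 1ℤ
    norm-step x y eq = trans (brahmagupta d p a x y) (cong₂ _*_ unit eq)
      where
      brahmagupta : ∀ d p a x y →
        (p * x + d * a * y) * (p * x + d * a * y) - d * ((a * x + p * y) * (a * x + p * y))
        ≡ (p * p - d * (a * a)) * (x * x - d * (y * y))
      brahmagupta = solve-∀

    norm-power : ∀ n → xₙ n * xₙ n - d * (yₙ n * yₙ n) ≡ 1ℤ
    norm-power zero    = lemma d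
      where
      lemma : ∀ d → 1ℤ * 1ℤ - d * (0ℤ * 0ℤ) ≡ 1ℤ
      lemma = solve-∀
    norm-power (suc n) = norm-step (xₙ n) (yₙ n) (norm-power n)

    -- Multiplication by `p + a √d` has trace `2 p` and determinant `p * p - d * (a * a)`; by `unit`
    -- the latter is 1, whence the parameter `-1ℤ`.
    2*xₙ≡V : ∀ n → + 2 * xₙ n ≡ V (+ 2 * p) -1ℤ n
    2*xₙ≡V zero          = refl
    2*xₙ≡V (suc zero)    = lemma d p a
      where
      lemma : ∀ d p a → + 2 * (p * 1ℤ + d * a * 0ℤ) ≡ + 2 * p
      lemma = solve-∀
    2*xₙ≡V (suc (suc n)) = begin
      + 2 * xₙ (suc (suc n))
        ≡⟨ cayley-hamilton d p a (xₙ n) (yₙ n) ⟩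
      + 2 * p * (+ 2 * xₙ (suc n)) + -1ℤ * (p * p - d * (a * a)) * (+ 2 * xₙ n)
        -- At `N = 1ℤ` the coefficient `-1ℤ * N` computes to `-1ℤ`.
        ≡⟨ cong (λ N → + 2 * p * (+ 2 * xₙ (suc n)) + -1ℤ * N * (+ 2 * xₙ n)) unit ⟩
      + 2 * p * (+ 2 * xₙ (suc n)) + -1ℤ * (+ 2 * xₙ n)
        ≡⟨ cong₂ (λ v w → + 2 * p * v + -1ℤ * w) (2*xₙ≡V (suc n)) (2*xₙ≡V n) ⟩
      V (+ 2 * p) -1ℤ (suc (suc n)) ∎
      where
      open ≡-Reasoning
      cayley-hamilton : ∀ d p a x y →
        + 2 * (p * (p * x + d * a * y) + d * a * (a * x + p * y))
        ≡ + 2 * p * (+ 2 * (p * x + d * a * y)) + -1ℤ * (p * p - d * (a * a)) * (+ 2 * x)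
      cayley-hamilton = solve-∀

    -- Same recursion as for `xₙ`; the initial values 0 and `a` are `a` times those of `U`.
    yₙ≡a*U : ∀ n → yₙ n ≡ a * U (+ 2 * p) -1ℤ n
    yₙ≡a*U zero          = sym (*-zeroʳ a)
    yₙ≡a*U (suc zero)    = lemma p a
      where
      lemma : ∀ p a → a * 1ℤ + p * 0ℤ ≡ a * 1ℤ
      lemma = solve-∀
    yₙ≡a*U (suc (suc n)) = begin
      yₙ (suc (suc n))
        ≡⟨ cayley-hamilton d p a (xₙ n) (yₙ n) ⟩
      + 2 * p * yₙ (suc n) + -1ℤ * (p * p - d * (a * a)) * yₙ n
        ≡⟨ cong (λ N → + 2 * p * yₙ (suc n) + -1ℤ * N * yₙ n) unit ⟩
      + 2 * p * yₙ (suc n) + -1ℤ * yₙ n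
        ≡⟨ cong₂ (λ v w → + 2 * p * v + -1ℤ * w) (yₙ≡a*U (suc n)) (yₙ≡a*U n) ⟩
      + 2 * p * (a * u₁) + -1ℤ * (a * u₀)
        ≡⟨ factor p a u₁ u₀ ⟩
      a * U (+ 2 * p) -1ℤ (suc (suc n)) ∎
      where
      open ≡-Reasoning
      u₀ = U (+ 2 * p) -1ℤ n
      u₁ = U (+ 2 * p) -1ℤ (suc n)
      cayley-hamilton : ∀ d p a x y →
        a * (p * x + d * a * y) + p * (a * x + p * y)
        ≡ + 2 * p * (a * x + p * y) + -1ℤ * (p * p - d * (a * a)) * y
      cayley-hamilton = solve-∀
      factor : ∀ p a u₁ u₀ →
        + 2 * p * (a * u₁) + -1ℤ * (a * u₀) ≡ a * (+ 2 * p * u₁ + -1ℤ * u₀)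
      factor = solve-∀

    -- Positivity and descent.

    module _ (0≤d : 0ℤ ≤ d) (0<p : 0ℤ < p) (0<a : 0ℤ < a) where

      0<xₙ : ∀ n → 0ℤ < xₙ n
      0≤yₙ : ∀ n → 0ℤ ≤ yₙ n
      0<yₛₙ : ∀ n → 0ℤ < yₙ (suc n)
      0<xₙ zero     = +<+ (ℕ.s≤s ℕ.z≤n)
      0<xₙ (suc n)  = +-mono-<-≤ (0<i*j 0<p (0<xₙ n)) (0≤i*j (0≤i*j 0≤d (<⇒≤ 0<a)) (0≤yₙ n))
      0≤yₙ zero     = ≤-refl
      0≤yₙ (suc n)  = <⇒≤ (0<yₛₙ n)
      0<yₛₙ n       = +-mono-<-≤ (0<i*j 0<a (0<xₙ n)) (0≤i*j (<⇒≤ 0<p) (0≤yₙ n))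

      -- `x′ + y′ √d` is `x + y √d` times `p - a √d`, which by `unit` is the inverse of `p + a √d`.
      descent : ∀ {x y} → 0ℤ < x → a < y → x * x - d * (y * y) ≡ 1ℤ →
        ∃[ x′ ] ∃[ y′ ] (0ℤ < x′ × 0ℤ < y′ × y′ < y × x′ * x′ - d * (y′ * y′) ≡ 1ℤ ×
          x ≡ p * x′ + d * a * y′ × y ≡ a * x′ + p * y′)
      descent {x} {y} 0<x a<y eq =
        x′ , y′ , 0<x′ , 0<y′ , y′<y , norm′ , x≡ , y≡
        where
        x′ = p * x - d * a * y
        y′ = p * y - a * x

        0<y : 0ℤ < y
        0<y = <-trans 0<a a<y

        -- With both norms 1 this is `(p x)² = (d a y)² + x² + d a²`, whose last two terms have a
        -- positive sum. The `+ 0ℤ` fits the shape of `exchange-<`.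
        x-identity : ∀ d p a x y →
          p * x * (p * x) + 0ℤ
          ≡ d * a * y * (d * a * y)
            + (x * x * (p * p - d * (a * a)) + d * (a * a) * (x * x - d * (y * y)))
        x-identity = solve-∀

        -- With both norms 1 this is `(p y)² + a² = (a x)² + y²`, so `a < y` yields `a x < p y`.
        y-identity : ∀ d p a x y →
          p * y * (p * y) + a * a * (x * x - d * (y * y))
          ≡ a * x * (a * x) + y * y * (p * p - d * (a * a))
        y-identity = solve-∀

        day<px : d * a * y < p * x
        day<px = square-cancel-< (<⇒≤ (0<i*j 0<p 0<x)) (exchange-<
          (subst₂ (λ M N → p * x * (p * x) + 0ℤ
                           ≡ d * a * y * (d * a * y) + (x * x * M + d * (a * a) * N))
            unit eq (x-identity d p a x y))
          (+-mono-<-≤ (0<i*j (0<i*j 0<x 0<x) (+<+ (ℕ.s≤s ℕ.z≤n)))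
            (0≤i*j (0≤i*j 0≤d (<⇒≤ (0<i*j 0<a 0<a))) (<⇒≤ (+<+ (ℕ.s≤s ℕ.z≤n))))))

        ax<py : a * x < p * y
        ax<py = square-cancel-< (<⇒≤ (0<i*j 0<p 0<y)) (exchange-<
          (subst₂ (λ M N → p * y * (p * y) + a * a * M ≡ a * x * (a * x) + y * y * N)
            eq unit (y-identity d p a x y))
          (*-monoʳ-<-pos 1ℤ (square-mono-< (<⇒≤ 0<a) a<y)))

        i<j⇒0<j-i : ∀ {i j} → i < j → 0ℤ < j - i
        i<j⇒0<j-i {i} {j} i<j = subst (_< j - i) (+-inverseʳ i) (+-monoˡ-< (- i) i<j)

        0<x′ : 0ℤ < x′
        0<x′ = i<j⇒0<j-i day<px

        0<y′ : 0ℤ < y′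
        0<y′ = i<j⇒0<j-i ax<py

        norm′ : x′ * x′ - d * (y′ * y′) ≡ 1ℤ
        norm′ = trans (brahmagupta d p a x y) (cong₂ _*_ unit eq)
          where
          brahmagupta : ∀ d p a x y →
            (p * x - d * a * y) * (p * x - d * a * y) - d * ((p * y - a * x) * (p * y - a * x))
            ≡ (p * p - d * (a * a)) * (x * x - d * (y * y))
          brahmagupta = solve-∀

        -- Multiplying back by `p + a √d` leaves a factor equal to its norm, which is 1.
        x≡ : x ≡ p * x′ + d * a * y′
        x≡ = trans (trans (sym (*-identityˡ x)) (cong (_* x) (sym unit))) (inverse d p a x y)
          where
          inverse : ∀ d p a x y → (p * p - d * (a * a)) * x
            ≡ p * (p * x - d * a * y) + d * a * (p * y - a * x)
          inverse = solve-∀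

        y≡ : y ≡ a * x′ + p * y′
        y≡ = trans (trans (sym (*-identityˡ y)) (cong (_* y) (sym unit))) (inverse d p a x y)
          where
          inverse : ∀ d p a x y → (p * p - d * (a * a)) * y
            ≡ a * (p * x - d * a * y) + p * (p * y - a * x)
          inverse = solve-∀

        y′<y : y′ < y
        -- In `y = a x′ + p y′` the first term is positive and `p ≥ 1`.
        y′<y = subst₂ _<_ (+-identityˡ y′) (sym y≡)
          (+-mono-<-≤ (0<i*j 0<a 0<x′) (0<i⇒i≤j*i 0<y′ 0<p))

      module _ (minimal : ∀ {x y} → 0ℤ < x → 0ℤ < y → x * x - d * (y * y) ≡ 1ℤ → a ≤ y) where

        -- Induction on `∣ y ∣`, which brings the descent into the well-founded order of ℕ. It stops
        -- at `y = a`, the first power.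
        solutions-are-powers : ∀ {x y} → 0ℤ < x → 0ℤ < y → x * x - d * (y * y) ≡ 1ℤ →
          ∃[ n ] (x ≡ xₙ (suc n) × y ≡ yₙ (suc n))
        solutions-are-powers = go (<-wellFounded _)
          where
          go : ∀ {x y} → Acc ℕ._<_ ∣ y ∣ → 0ℤ < x → 0ℤ < y → x * x - d * (y * y) ≡ 1ℤ →
            ∃[ n ] (x ≡ xₙ (suc n) × y ≡ yₙ (suc n))
          go {x} {y} (acc rec) 0<x 0<y eq with <-cmp a y
          ... | tri> _ _ y<a = contradiction (minimal 0<x 0<y eq) (<⇒≱ y<a)
          ... | tri≈ _ refl _ = 0 , trans x≡p (x-base d p a) , y-base p a
            where
            x≡p : x ≡ p
            -- Cancelling `- d a²` from the two norm equations leaves `x² = p²`.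
            x≡p = square-injective (<⇒≤ 0<x) (<⇒≤ 0<p)
              (∙-cancelʳ (AbelianGroup.group +-0-abelianGroup) _ _ _ (trans eq (sym unit)))
            x-base : ∀ d p a → p ≡ p * 1ℤ + d * a * 0ℤ
            x-base = solve-∀
            y-base : ∀ p a → a ≡ a * 1ℤ + p * 0ℤ
            y-base = solve-∀
          ... | tri< a<y _ _ =
            let x′ , y′ , 0<x′ , 0<y′ , y′<y , eq′ , x≡ , y≡ = descent 0<x a<y eq
                n , x′≡ , y′≡ = go (rec (∣-∣-mono-< 0<y′ y′<y)) 0<x′ 0<y′ eq′
            in suc n
               , trans x≡ (cong₂ (λ u v → p * u + d * a * v) x′≡ y′≡)
               , trans y≡ (cong₂ (λ u v → a * u + p * v) x′≡ y′≡)

-- The equation with `d = a² b² - 2 b`.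

minimal-solution : ∀ {a b x y} → 0ℤ < a → 0ℤ < b → 0ℤ < x → 0ℤ < y →
  x * x - (a ^ 2 * b ^ 2 - + 2 * b) * (y * y) ≡ 1ℤ → a ≤ y
minimal-solution {a} {b} {x} {y} 0<a 0<b 0<x 0<y eq = ≮⇒≥ λ y<a →
  <⇒≱ (lower y<a) (i<j⇒i≤pred[j] upper)
  where
  aby : ℤ
  aby = a * b * y

  0≤aby : 0ℤ ≤ aby
  0≤aby = <⇒≤ (0<i*j (0<i*j 0<a 0<b) 0<y)

  -- With norm 1: `(a b y)² + 1 = x² + 2 b y²`, and `1 < 2 b y²`.
  upper-identity : ∀ a b x y →
    a * b * y * (a * b * y)
      + (x * x - (a * (a * 1ℤ) * (b * (b * 1ℤ)) - + 2 * b) * (y * y))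
    ≡ x * x + + 2 * (b * y * y)
  upper-identity = solve-∀

  upper : x < aby
  upper = square-cancel-< 0≤aby (exchange-<
    (subst (λ N → aby * aby + N ≡ x * x + + 2 * (b * y * y)) eq (upper-identity a b x y))
    (0<i⇒1<2*i (0<i*j (0<i*j 0<b 0<y) 0<y)))

  -- With norm 1: `x² + (2 b y² + 1) = (a b y - 1)² + (2 b y a + 1)`, where `y <
  -- a` compares the brackets. `-1ℤ + a * b * y` is `pred aby` unfolded.
  lower-identity : ∀ a b x y →
    x * x + (+ 2 * (b * y * y) + 1ℤ)
    ≡ (-1ℤ + a * b * y) * (-1ℤ + a * b * y) + (+ 2 * (b * y * a)
      + (x * x - (a * (a * 1ℤ) * (b * (b * 1ℤ)) - + 2 * b) * (y * y)))
  lower-identity = solve-∀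

  lower : y < a → pred aby < x
  lower y<a = square-cancel-< (<⇒≤ 0<x) (exchange-<
    (subst (λ N → x * x + (+ 2 * (b * y * y) + 1ℤ)
                  ≡ pred aby * pred aby + (+ 2 * (b * y * a) + N))
      eq (lower-identity a b x y))
    (+-monoˡ-< 1ℤ (*-monoˡ-<-pos (+ 2)
      (*-monoˡ-<-pos (b * y) {{positive (0<i*j 0<b 0<y)}} y<a))))

theorem10 : (a b : ℤ) → 0ℤ < a → 0ℤ < b →
    let k = + 2 * a ^ 2 * b - + 2
        d = a ^ 2 * b ^ 2 - + 2 * b
    in Admissible k -1ℤ →
       -- x = V n / 2 is written as 2 x = V n; the first part includes that V n is even.
       (∀ (n : ℕ) → 1 ℕ.≤ n →
          ∃[ x ] (+ 2 * x ≡ V k -1ℤ n × IsPositivePellSolution d x (a * U k -1ℤ n)))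
       ×
       (∀ (x y : ℤ) → IsPositivePellSolution d x y →
          ∃[ n ] (1 ℕ.≤ n × + 2 * x ≡ V k -1ℤ n × y ≡ a * U k -1ℤ n))
theorem10 a b 0<a 0<b admissible = powers-are-solutions , solutions-are-powers′
  where
  k d p : ℤ
  k = + 2 * a ^ 2 * b - + 2
  d = a ^ 2 * b ^ 2 - + 2 * b
  p = a * a * b - 1ℤ

  open Powers d p a

  unit : p * p - d * (a * a) ≡ 1ℤ
  unit = lemma a b
    where
    lemma : ∀ a b →
      (a * a * b - 1ℤ) * (a * a * b - 1ℤ)
        - (a * (a * 1ℤ) * (b * (b * 1ℤ)) - + 2 * b) * (a * a) ≡ 1ℤ
    lemma = solve-∀

  2p≡k : + 2 * p ≡ k
  2p≡k = lemma a b
    where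
    lemma : ∀ a b → + 2 * (a * a * b - 1ℤ) ≡ + 2 * (a * (a * 1ℤ)) * b - + 2
    lemma = solve-∀

  0<p : 0ℤ < p
  -- `a² b ≥ 1` gives only `0 ≤ p`. The case `p = 0`, that is `a = b = 1`, is excluded by `k ≢ 0ℤ`,
  -- as `k = 2 p`.
  0<p = ≤∧≢⇒< (i≤j⇒0≤j-i (i<j⇒suc[i]≤j (0<i*j (0<i*j 0<a 0<a) 0<b)))
    λ 0≡p → Admissible.k≢0 admissible (trans (sym 2p≡k) (cong (+ 2 *_) (sym 0≡p)))

  0≤d : 0ℤ ≤ d
  -- `d = b (p - 1)` with `p ≥ 1`; the value 0 occurs at `a = 1`, `b = 2`.
  0≤d = subst (0ℤ ≤_) (lemma a b)
    (0≤i*j (<⇒≤ 0<b) (i≤j⇒0≤j-i (i<j⇒suc[i]≤j 0<p)))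
    where
    lemma : ∀ a b →
      b * (a * a * b - 1ℤ - 1ℤ) ≡ a * (a * 1ℤ) * (b * (b * 1ℤ)) - + 2 * b
    lemma = solve-∀

  2*xₙ≡Vk : ∀ n → + 2 * xₙ n ≡ V k -1ℤ n
  2*xₙ≡Vk n = trans (2*xₙ≡V unit n) (cong (λ l → V l -1ℤ n) 2p≡k)

  yₙ≡a*Uk : ∀ n → yₙ n ≡ a * U k -1ℤ n
  yₙ≡a*Uk n = trans (yₙ≡a*U unit n) (cong (λ l → a * U l -1ℤ n) 2p≡k)

  powers-are-solutions : ∀ n → 1 ℕ.≤ n →
    ∃[ x ] (+ 2 * x ≡ V k -1ℤ n × IsPositivePellSolution d x (a * U k -1ℤ n))
  powers-are-solutions (suc n) _ =
    xₙ (suc n) , 2*xₙ≡Vk (suc n) ,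
    subst (IsPositivePellSolution d (xₙ (suc n))) (yₙ≡a*Uk (suc n))
      ( 0<xₙ unit 0≤d 0<p 0<a (suc n)
      , 0<yₛₙ unit 0≤d 0<p 0<a n
      , trans (norm d (xₙ (suc n)) (yₙ (suc n))) (norm-power unit (suc n)))

  solutions-are-powers′ : ∀ x y → IsPositivePellSolution d x y →
    ∃[ n ] (1 ℕ.≤ n × + 2 * x ≡ V k -1ℤ n × y ≡ a * U k -1ℤ n)
  solutions-are-powers′ x y (0<x , 0<y , eq) =
    let n , x≡ , y≡ = solutions-are-powers unit 0≤d 0<p 0<a (minimal-solution 0<a 0<b)
                        0<x 0<y (trans (sym (norm d x y)) eq)
    in suc n , ℕ.s≤s ℕ.z≤n
       , trans (cong (+ 2 *_) x≡) (2*xₙ≡Vk (suc n))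
       , trans y≡ (yₙ≡a*Uk (suc n))
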